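{- For each $k \in \mathbb{N}$, every (finite) graph $G$ with chromatic number $\chi(G) \ge 7k+1$ contains a subgraph $H$ with both connectivity $\kappa(H) \ge k$ and chromatic number $\chi(H) \ge k$.
   Context: $\chi$ denotes chromatic number and $\kappa$ denotes vertex connectivity. -}

module Defs where

open import Data.Nat using (ℕ; _≤_; _<_)
open import Data.Bool using (Bool; true; false)
open import Data.Fin using (Fin)
open import Data.Fin.Subset using (Subset; _∈_; _∉_; ∣_∣)
open import Data.Product using (Σ; _×_)
open import Data.Sum using (_⊎_)
open import Function.Definitions using (Injective)
open import Relation.Binary.PropositionalEquality using (_≡_; _≢_)

record Graph : Set where
  field
    size   : ℕ
    adj    : Fin size → Fin size → Bool
    sym    : ∀ u v → adj u v ≡ adj v u
    irrefl : ∀ u → adj u u ≡ false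
open Graph public

Edge : (G : Graph) → Fin (size G) → Fin (size G) → Set
Edge G u v = adj G u v ≡ true

Colouring : (G : Graph) → ℕ → Set
Colouring G c = Σ (Fin (size G) → Fin c) λ col →
  ∀ u v → Edge G u v → col u ≢ col v

ChromaticAtLeast : Graph → ℕ → Set
ChromaticAtLeast G m = ∀ c → Colouring G c → m ≤ c

data ReachAvoiding (G : Graph) (X : Subset (size G)) : Fin (size G) → Fin (size G) → Set where
  here : ∀ {u} → ReachAvoiding G X u u
  step : ∀ {u v w} → Edge G u v → v ∉ X → ReachAvoiding G X v w → ReachAvoiding G X u w

ConnectedMinus : (G : Graph) → Subset (size G) → Set
ConnectedMinus G X = ∀ u v → u ∉ X → v ∉ X → ReachAvoiding G X u v

-- G is k-connected (Diestel): |G| > k and G − X connected for every X with |X| < k.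
KConnected : Graph → ℕ → Set
KConnected G k = (k < size G) × (∀ (X : Subset (size G)) → ∣ X ∣ < k → ConnectedMinus G X)

-- κ(G) ≥ k, where κ(G) = greatest k such that G is k-connected (κ ≥ 0 always).
ConnectivityAtLeast : Graph → ℕ → Set
ConnectivityAtLeast G k = (k ≡ 0) ⊎ KConnected G k

-- H is a subgraph of G (up to relabelling): an injective vertex map preserving edges.
record Subgraph (H G : Graph) : Set where
  field
    emb     : Fin (size H) → Fin (size G)
    emb-inj : Injective _≡_ _≡_ emb
    emb-adj : ∀ u v → Edge H u v → Edge G (emb u) (emb v)

{-# OPTIONS --safe #-}
module Submission where

-- Suppose that no induced subgraph of G is both k-connected and of chromatic number at least k.
-- Then every vertex set either induces a k-colourable graph or has a separation of order < k, and
-- a 7k-colouring of G is built by induction from partial data: some vertices are precoloured, and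
-- every other vertex v has a set of at most k forbidden colours.  A precoloured vertex weighs k, any
-- other vertex weighs its number of forbidden colours, and the total weight stays at most 2k².
--  * A vertex with k forbidden colours is coloured, at no cost.
--  * A precoloured vertex with at most k uncoloured neighbours is deleted and its colour is
--    forbidden at these neighbours, at no cost.
--  * Otherwise, take a separation (A, B) of order < k.  Precoloured vertices now have more than k
--    uncoloured neighbours, so both sides contain uncoloured vertices.  One side, say B ∖ A, weighs at
--    most k².  First colour A together with all precoloured vertices, then fix the resulting colours
--    on A ∩ B and colour B, whose weight is now at most k² + k · k.
--  * If there is no separation, the graph has k colour classes.  Averaging gives each class its own
--    colour, unused by precoloured vertices, such that at most k vertices receive a forbidden colour;
--    these few vertices are recoloured with pairwise distinct new colours.

open import Defs renaming (sym to adj-sym)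
import Data.Nat.Properties
open import Algebra.Properties.Semiring.Sum Data.Nat.Properties.+-*-semiring
  using (sum; sum-cong-≗; ∑-distrib-+; ∑-comm; *-distribˡ-sum)
open import Data.Bool using (Bool; true; false; _∨_; not)
import Data.Bool as Bool
open import Data.Empty using (⊥)
open import Data.Fin using (Fin; zero; suc; _≟_; fromℕ<; inject≤)
open import Data.Fin.Properties using (any?; suc-injective; inject≤-injective)
open import Data.Fin.Subset using (Subset; ∣_∣; _∉_)
open import Data.Fin.Subset.Properties using (_∈?_)
open import Data.Nat using (ℕ; zero; suc; _+_; _*_; _≤_; _<_; z≤n; s≤s; z<s; _<?_; _≤?_; NonZero; >-nonZero)
open import Data.Nat.Induction using (<-wellFounded)
open import Data.Nat.Properties hiding (_≟_; _≤?_; _<?_; suc-injective)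
open import Data.Nat.Tactic.RingSolver using (solve-∀)
open import Data.Product using (Σ; ∃; _×_; _,_)
open import Data.Sum using (_⊎_; inj₁; inj₂; [_,_]′)
open import Data.Unit using (⊤; tt)
open import Data.Vec using (Vec; []; _∷_; lookup; tabulate)
open import Data.Vec.Properties using (lookup∘tabulate; lookup⇒[]=; []=⇒lookup)
open import Function using (_∘_)
open import Induction.WellFounded using (Acc; acc)
open import Relation.Binary.PropositionalEquality using (_≡_; _≢_; refl; sym; trans; cong; cong₂; subst)
open import Relation.Nullary using (¬_; Dec; yes; no; contradiction; does)
open import Relation.Nullary.Decidable using (_×-dec_; ¬?)

-- Finite sums and greedy choices

sum-mono-≤ : ∀ {n} {f g : Fin n → ℕ} → (∀ i → f i ≤ g i) → sum f ≤ sum g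
sum-mono-≤ {zero}  f≤g = z≤n
sum-mono-≤ {suc n} f≤g = +-mono-≤ (f≤g zero) (sum-mono-≤ (f≤g ∘ suc))

sum-mono-< : ∀ {n} {f g : Fin n → ℕ} → (∀ i → f i ≤ g i) → ∀ i → f i < g i → sum f < sum g
sum-mono-< f≤g zero    f<g = +-mono-<-≤ f<g (sum-mono-≤ (f≤g ∘ suc))
sum-mono-< f≤g (suc i) f<g = +-mono-≤-< (f≤g zero) (sum-mono-< (f≤g ∘ suc) i f<g)

-- The averaging principle behind every choice of a colour below. If the first index fails,
-- cancelling its terms keeps the strict inequality for the remaining ones.
sum-<⇒∃< : ∀ {n} (f g : Fin n → ℕ) → sum f < sum g → ∃ λ i → f i < g i
sum-<⇒∃< {suc n} f g lt with f zero <? g zero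
... | yes f<g = zero , f<g
... | no  f≮g with sum-<⇒∃< (f ∘ suc) (g ∘ suc)
                     (+-cancelˡ-< (g zero) _ _ (≤-<-trans (+-monoˡ-≤ _ (≮⇒≥ f≮g)) lt))
...   | i , f<g = suc i , f<g

sum-const : ∀ n t → sum {n} (λ _ → t) ≡ n * t
sum-const zero    t = refl
sum-const (suc n) t = cong (t +_) (sum-const n t)

sum-zero : ∀ m → sum {m} (λ _ → 0) ≡ 0
sum-zero m = trans (sum-const m 0) (*-zeroʳ m)

f≤sum : ∀ {n} (f : Fin n → ℕ) i → f i ≤ sum f
f≤sum f zero    = m≤m+n _ _
f≤sum f (suc i) = ≤-trans (f≤sum (f ∘ suc) i) (m≤n+m _ _)

ind : Bool → ℕ
ind true  = 1
ind false = 0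

-- Kronecker delta. It is defined by recursion so that the successor case of `sum-δ-*` is the
-- induction hypothesis itself.
δ : ∀ {n} → Fin n → Fin n → ℕ
δ zero    zero    = 1
δ zero    (suc _) = 0
δ (suc _) zero    = 0
δ (suc i) (suc j) = δ i j

δ-refl : ∀ {n} (i : Fin n) → δ i i ≡ 1
δ-refl zero    = refl
δ-refl (suc i) = δ-refl i

δ≡0⇒≢ : ∀ {n} {i j : Fin n} → δ i j ≡ 0 → i ≢ j
δ≡0⇒≢ {i = i} δ≡0 refl = contradiction (trans (sym (δ-refl i)) δ≡0) λ ()

≢⇒δ≡0 : ∀ {n} {i j : Fin n} → i ≢ j → δ i j ≡ 0
≢⇒δ≡0 {i = zero}  {zero}  i≢j = contradiction refl i≢j
≢⇒δ≡0 {i = zero}  {suc j} i≢j = refl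
≢⇒δ≡0 {i = suc i} {zero}  i≢j = refl
≢⇒δ≡0 {i = suc i} {suc j} i≢j = ≢⇒δ≡0 (i≢j ∘ cong suc)

sum-δ-* : ∀ {n} (i : Fin n) (f : Fin n → ℕ) → sum (λ j → δ i j * f j) ≡ f i
sum-δ-* {suc n} zero    f = trans (cong₂ _+_ (*-identityˡ (f zero)) (sum-zero n)) (+-identityʳ (f zero))
sum-δ-* {suc n} (suc i) f = sum-δ-* i (f ∘ suc)

sum-δ : ∀ {n} (i : Fin n) → sum (δ i) ≡ 1
sum-δ i = trans (sum-cong-≗ (λ j → sym (*-identityʳ (δ i j)))) (sum-δ-* i (λ _ → 1))

-- Measures the growth of a list of forbidden colours when the colour of a deleted neighbour is
-- added to it.
sum-∨-≟ : ∀ {N} (F : Fin N → Bool) c → sum (λ d → ind (F d ∨ does (c ≟ d))) ≤ sum (ind ∘ F) + 1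
sum-∨-≟ F c = subst (sum (λ d → ind (F d ∨ does (c ≟ d))) ≤_)
  (trans (∑-distrib-+ (ind ∘ F) (δ c)) (cong (sum (ind ∘ F) +_) (sum-δ c)))
  (sum-mono-≤ pointwise)
  where
  pointwise : ∀ d → ind (F d ∨ does (c ≟ d)) ≤ ind (F d) + δ c d
  pointwise d with F d | c ≟ d
  ... | true  | _        = s≤s z≤n
  ... | false | yes refl = ≤-reflexive (sym (δ-refl c))
  ... | false | no _     = z≤n

-- Greedy choice: each colour already taken costs i at most t i, hence the term (number of active indices) * t i.
distinctChoice : ∀ {N} → Fin N → ∀ n (active : Fin n → Bool) (t : Fin n → ℕ) (g : Fin n → Fin N → ℕ) →
  (∀ i → active i ≡ true → sum (g i) + sum (ind ∘ active) * t i < N * t i) →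
  ∃ λ (σ : Fin n → Fin N) →
    (∀ i → active i ≡ true → g i (σ i) < t i) ×
    (∀ i j → active i ≡ true → active j ≡ true → σ i ≡ σ j → i ≡ j)
distinctChoice         c₀ zero    active t g small = (λ ()) , (λ ()) , λ ()
distinctChoice {N}     c₀ (suc n) active t g small with active zero in eq
... | false with distinctChoice c₀ n (active ∘ suc) (t ∘ suc) (g ∘ suc) (λ i → small (suc i))
...   | σ , good , inj = σ′ , good′ , inj′
  where
  σ′ : Fin (suc n) → Fin N
  -- Nothing is required at an inactive index, so a default colour is assigned there.
  σ′ zero    = c₀
  σ′ (suc i) = σ i
  good′ : ∀ i → active i ≡ true → g i (σ′ i) < t i
  good′ zero    a = contradiction (trans (sym eq) a) λ ()
  good′ (suc i) a = good i a
  inj′ : ∀ i j → active i ≡ true → active j ≡ true → σ′ i ≡ σ′ j → i ≡ j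
  inj′ zero    _       a _ _ = contradiction (trans (sym eq) a) λ ()
  inj′ (suc _) zero    _ a _ = contradiction (trans (sym eq) a) λ ()
  inj′ (suc i) (suc j) a b e = cong suc (inj i j a b e)
distinctChoice {N} c₀ (suc n) active t g small | true
  with sum-<⇒∃< (g zero) (λ _ → t zero)
         (<-≤-trans (≤-<-trans (m≤m+n _ _) (small zero eq)) (≤-reflexive (sym (sum-const N (t zero)))))
... | c , gc<t with distinctChoice c₀ n (active ∘ suc) (t ∘ suc) (λ i d → g (suc i) d + t (suc i) * δ c d) small′
  where
  rearrange : ∀ a b s → a + (1 + b) * s ≡ (a + s * 1) + b * s
  rearrange = solve-∀
  small′ : ∀ i → active (suc i) ≡ true →
    sum (λ d → g (suc i) d + t (suc i) * δ c d) + sum (ind ∘ active ∘ suc) * t (suc i) < N * t (suc i)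
  small′ i a = subst (_< N * t (suc i))
    (trans (rearrange (sum (g (suc i))) (sum (ind ∘ active ∘ suc)) (t (suc i)))
      (cong (_+ _) (sym (trans (∑-distrib-+ (g (suc i)) _)
        (cong (sum (g (suc i)) +_) (trans (sym (*-distribˡ-sum (t (suc i)) (δ c))) (cong (t (suc i) *_) (sum-δ c))))))))
    (small (suc i) a)
...   | σ , good , inj = σ′ , good′ , inj′
  where
  σ′ : Fin (suc n) → Fin N
  σ′ zero    = c
  σ′ (suc i) = σ i
  good′ : ∀ i → active i ≡ true → g i (σ′ i) < t i
  good′ zero    a = gc<t
  good′ (suc i) a = ≤-<-trans (m≤m+n _ _) (good i a)
  -- The penalty at `c` alone is `t (suc i)`, which already breaks the strict bound in `good`.
  c≢σ : ∀ i → active (suc i) ≡ true → c ≢ σ i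
  c≢σ i a refl = <-irrefl refl (<-≤-trans (good i a)
    (≤-trans (≤-reflexive (sym (trans (cong (t (suc i) *_) (δ-refl (σ i))) (*-identityʳ _)))) (m≤n+m _ _)))
  inj′ : ∀ i j → active i ≡ true → active j ≡ true → σ′ i ≡ σ′ j → i ≡ j
  inj′ zero    zero    _ _ _ = refl
  inj′ zero    (suc j) _ b e = contradiction e (c≢σ j b)
  inj′ (suc i) zero    a _ e = contradiction (sym e) (c≢σ i a)
  inj′ (suc i) (suc j) a b e = cong suc (inj i j a b e)

-- Separations and induced subgraphs

-- Constructive substitute for a classical case distinction over a finite type. Taking evidence `Q`
-- instead of a bare negation of `P` makes a failed search return a usable certificate.
Searchable : Set → Set₁
Searchable A = ∀ {P Q : A → Set} → (∀ x → P x ⊎ Q x) → (∀ x → P x) ⊎ ∃ Q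

Bool-searchable : Searchable Bool
Bool-searchable dec with dec true | dec false
... | inj₂ q | _      = inj₂ (true , q)
... | inj₁ _ | inj₂ q = inj₂ (false , q)
... | inj₁ p | inj₁ r = inj₁ λ { true → p ; false → r }

Fin-searchable : ∀ {n} → Searchable (Fin n)
Fin-searchable {zero}  dec = inj₁ λ ()
Fin-searchable {suc n} dec with dec zero | Fin-searchable (dec ∘ suc)
... | inj₂ q | _            = inj₂ (zero , q)
... | inj₁ _ | inj₂ (i , q) = inj₂ (suc i , q)
... | inj₁ p | inj₁ ps      = inj₁ λ { zero → p ; (suc i) → ps i }

-- Nested search, one coordinate at a time. Subsets are vectors over `Bool` and colour assignments
-- are vectors over `Fin k`, so both can be searched.
Vec-searchable : ∀ {A} → Searchable A → ∀ {n} → Searchable (Vec A n)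
Vec-searchable search {zero} dec with dec []
... | inj₁ p = inj₁ λ { [] → p }
... | inj₂ q = inj₂ ([] , q)
Vec-searchable search {suc n} dec with search (λ x → Vec-searchable search (λ xs → dec (x ∷ xs)))
... | inj₁ p             = inj₁ λ { (x ∷ xs) → p x xs }
... | inj₂ (x , xs , q) = inj₂ ((x ∷ xs) , q)

∣∣≡sum : ∀ {n} (X : Subset n) → ∣ X ∣ ≡ sum (ind ∘ lookup X)
∣∣≡sum []          = refl
∣∣≡sum (true ∷ X)  = cong suc (∣∣≡sum X)
∣∣≡sum (false ∷ X) = ∣∣≡sum X

data Part : Set where
  left mid right : Part

isMid : Part → ℕ
isMid mid = 1
isMid _   = 0

-- With sides A and B, the labels mean A minus B, the intersection, and B minus A. They are given to
-- all vertices of `G`, and `order` counts `mid` outside `S` too. The vertices `l` and `r` make the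
-- separation proper.
record Separation (G : Graph) (S : Subset (size G)) (k : ℕ) : Set where
  field
    part   : Fin (size G) → Part
    order  : sum (isMid ∘ part) < k
    l r    : Fin (size G)
    l∈S    : lookup S l ≡ true
    r∈S    : lookup S r ≡ true
    l-left  : part l ≡ left
    r-right : part r ≡ right
    no-edge : ∀ u v → lookup S u ≡ true → lookup S v ≡ true →
              part u ≡ left → part v ≡ right → ¬ Edge G u v

ColouringOn : (G : Graph) → Subset (size G) → ℕ → Set
ColouringOn G S c = Σ (Fin (size G) → Fin c) λ κ →
  ∀ u v → lookup S u ≡ true → lookup S v ≡ true → Edge G u v → κ u ≢ κ v

Good : ℕ → Graph → Graph → Set
Good k G H = Subgraph H G × ConnectivityAtLeast H k × ChromaticAtLeast H k

∉⇒false : ∀ {n} {X : Subset n} {v} → v ∉ X → lookup X v ≡ false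
∉⇒false {X = X} {v} v∉X with lookup X v in eq
... | true  = contradiction (lookup⇒[]= v X eq) v∉X
... | false = refl

false⇒∉ : ∀ {n} {X : Subset n} {v} → lookup X v ≡ false → v ∉ X
false⇒∉ eq v∈X = contradiction (trans (sym eq) ([]=⇒lookup v∈X)) λ ()

-- Components, and certificates against connectivity or large chromatic number

module _ (H : Graph) where

  snoc : ∀ {X u v w} → ReachAvoiding H X u v → Edge H v w → w ∉ X → ReachAvoiding H X u w
  snoc here         e w∉X = step e w∉X here
  snoc (step f z r) e w∉X = step f z (snoc r e w∉X)

  Closed : Subset (size H) → (Fin (size H) → Bool) → Set
  Closed X C = ∀ v w → C v ≡ true → w ∉ X → Edge H v w → C w ≡ true

  -- Start from the set containing only `u` and add the end of any edge leaving the current set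
  -- outside `X`. The complement shrinks each time, and a set with no such edge is closed.
  component : ∀ X u → ∃ λ C → C u ≡ true × (∀ v → C v ≡ true → ReachAvoiding H X u v) × Closed X C
  component X u = grow (λ v → does (u ≟ v)) (u∈ (u ≟ u)) reach₀ (<-wellFounded _)
    where
    u∈ : (d : Dec (u ≡ u)) → does d ≡ true
    u∈ (yes _) = refl
    u∈ (no ¬p) = contradiction refl ¬p
    reach₀ : ∀ v → does (u ≟ v) ≡ true → ReachAvoiding H X u v
    reach₀ v eq with u ≟ v
    ... | yes refl = here
    grow : ∀ C → C u ≡ true → (∀ v → C v ≡ true → ReachAvoiding H X u v) → Acc _<_ (sum (ind ∘ not ∘ C)) →
      ∃ λ C → C u ≡ true × (∀ v → C v ≡ true → ReachAvoiding H X u v) × Closed X C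
    grow C u∈C reach (acc rec)
      with any? (λ v → any? (λ w → (C v Bool.≟ true) ×-dec (adj H v w Bool.≟ true) ×-dec ¬? (w ∈? X) ×-dec (C w Bool.≟ false)))
    ... | yes (v , w , v∈C , e , w∉X , w∉C) = grow C′ (keep u u∈C) reach′ (rec (sum-mono-< smaller w strict))
      where
      C′ : Fin (size H) → Bool
      C′ x = C x ∨ does (w ≟ x)
      keep : ∀ x → C x ≡ true → C′ x ≡ true
      keep x eq rewrite eq = refl
      reach′ : ∀ x → C′ x ≡ true → ReachAvoiding H X u x
      reach′ x eq with C x in x∈C | w ≟ x
      ... | true  | _        = reach x x∈C
      ... | false | yes refl = snoc (reach v v∈C) e w∉X
      smaller : ∀ x → ind (not (C′ x)) ≤ ind (not (C x))
      smaller x with C x | does (w ≟ x)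
      ... | true  | _     = z≤n
      ... | false | true  = z≤n
      ... | false | false = ≤-refl
      strict : ind (not (C′ w)) < ind (not (C w))
      strict with w ≟ w
      ... | no ¬p = contradiction refl ¬p
      ... | yes _ rewrite w∉C = z<s
    ... | no ¬leak = C , u∈C , reach , closed
      where
      closed : Closed X C
      closed v w v∈C w∉X e with C w in w∈C
      ... | true  = refl
      ... | false = contradiction (v , w , v∈C , e , w∉X , w∈C) ¬leak

  -- A positive certificate that `X` disconnects `H`: a set closed under edges avoiding `X` that
  -- contains `u` but misses `v`. It carries the data from which a separation is built.
  record Disconnects (k : ℕ) (X : Subset (size H)) : Set where
    field
      small : ∣ X ∣ < k
      u v   : Fin (size H)
      u∉X   : u ∉ X
      v∉X   : v ∉ X
      C     : Fin (size H) → Bool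
      u∈C   : C u ≡ true
      v∉C   : C v ≡ false
      closed : Closed X C

  connected⊎disconnects : ∀ k X → (∣ X ∣ < k → ConnectedMinus H X) ⊎ Disconnects k X
  connected⊎disconnects k X with ∣ X ∣ <? k
  ... | no  ∣X∣≮k = inj₁ λ ∣X∣<k → contradiction ∣X∣<k ∣X∣≮k
  ... | yes ∣X∣<k with Fin-searchable (λ u → Fin-searchable (test u))
    where
    test : ∀ u v → (u ∉ X → v ∉ X → ReachAvoiding H X u v) ⊎ Disconnects k X
    test u v with u ∈? X | v ∈? X | component X u
    ... | yes u∈X | _       | _ = inj₁ λ u∉X → contradiction u∈X u∉X
    ... | no  _   | yes v∈X | _ = inj₁ λ _ v∉X → contradiction v∈X v∉X
    ... | no u∉X  | no v∉X  | C , u∈C , reach , closed with C v in eq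
    ...   | true  = inj₁ λ _ _ → reach v eq
    ...   | false = inj₂ record { small = ∣X∣<k ; u∉X = u∉X ; v∉X = v∉X ; C = C ; u∈C = u∈C ; v∉C = eq ; closed = closed }
  ...   | inj₁ conn            = inj₁ λ _ → conn
  ...   | inj₂ (_ , _ , disc) = inj₂ disc

  -- All assignments of `k` colours are searched. If none is proper, a colouring with at most `k`
  -- colours cannot exist either, since it could be read as one with `k` colours.
  chromatic⊎colouring : ∀ k → ChromaticAtLeast H (suc k) ⊎ Colouring H k
  chromatic⊎colouring k with Vec-searchable Fin-searchable {size H} test
    where
    Proper : Vec (Fin k) (size H) → Set
    Proper col = ∀ u v → Edge H u v → lookup col u ≢ lookup col v
    test : ∀ col → ¬ Proper col ⊎ Proper col
    test col with Fin-searchable {P = λ u → ∀ v → Edge H u v → lookup col u ≢ lookup col v}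
                   (λ u → Fin-searchable (λ v → edge? u v))
      where
      edge? : ∀ u v → (Edge H u v → lookup col u ≢ lookup col v) ⊎ (Edge H u v × lookup col u ≡ lookup col v)
      edge? u v with adj H u v | lookup col u ≟ lookup col v
      ... | false | _      = inj₁ λ ()
      ... | true  | yes eq = inj₂ (refl , eq)
      ... | true  | no neq = inj₁ λ _ → neq
    ... | inj₁ proper           = inj₂ proper
    ... | inj₂ (u , v , e , eq) = inj₁ λ proper → proper u v e eq
  ... | inj₂ (col , proper) = inj₂ (lookup col , proper)
  ... | inj₁ none = inj₁ bound
    where
    bound : ChromaticAtLeast H (suc k)
    bound c (col , proper) with k <? c
    ... | yes k<c = k<c
    ... | no  k≮c = contradiction
      (λ u v e eq → proper u v e (inject≤-injective c≤k c≤k _ _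
        (trans (sym (lookup∘tabulate _ u)) (trans eq (lookup∘tabulate _ v)))))
      (none (tabulate λ v → inject≤ (col v) c≤k))
      where c≤k = ≮⇒≥ k≮c

-- Induced subgraphs

embed : ∀ {n} (S : Subset n) → Fin ∣ S ∣ → Fin n
embed (true ∷ S)  zero    = zero
embed (true ∷ S)  (suc i) = suc (embed S i)
embed (false ∷ S) i       = suc (embed S i)

embed-injective : ∀ {n} (S : Subset n) {i j} → embed S i ≡ embed S j → i ≡ j
embed-injective (true ∷ S)  {zero}  {zero}  _  = refl
embed-injective (true ∷ S)  {suc i} {suc j} eq = cong suc (embed-injective S (suc-injective eq))
embed-injective (false ∷ S)                 eq = embed-injective S (suc-injective eq)

embed-surjective : ∀ {n} (S : Subset n) v → lookup S v ≡ true → ∃ λ i → embed S i ≡ v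
embed-surjective (true ∷ S) zero _ = zero , refl
embed-surjective (true ∷ S) (suc v) v∈S with embed-surjective S v v∈S
... | i , eq = suc i , cong suc eq
embed-surjective (false ∷ S) (suc v) v∈S with embed-surjective S v v∈S
... | i , eq = i , cong suc eq

embed∈ : ∀ {n} (S : Subset n) i → lookup S (embed S i) ≡ true
embed∈ (true ∷ S)  zero    = refl
embed∈ (true ∷ S)  (suc i) = embed∈ S i
embed∈ (false ∷ S) i       = embed∈ S i

extend : ∀ {A : Set} {n} (S : Subset n) → A → (Fin ∣ S ∣ → A) → Fin n → A
extend (true ∷ S)  a f zero    = f zero
extend (true ∷ S)  a f (suc v) = extend S a (f ∘ suc) v
extend (false ∷ S) a f zero    = a
extend (false ∷ S) a f (suc v) = extend S a f v

extend-embed : ∀ {A : Set} {n} (S : Subset n) (a : A) f i → extend S a f (embed S i) ≡ f i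
extend-embed (true ∷ S)  a f zero    = refl
extend-embed (true ∷ S)  a f (suc i) = extend-embed S a (f ∘ suc) i
extend-embed (false ∷ S) a f i       = extend-embed S a f i

-- Vertices outside `S` contribute only `g a`. Applied with default `right`, this shows that
-- labelling them does not raise the order of a separation.
sum-extend : ∀ {A : Set} {n} (S : Subset n) (a : A) f (g : A → ℕ) → g a ≡ 0 →
  sum (g ∘ extend S a f) ≡ sum (g ∘ f)
sum-extend []          a f g eq = refl
sum-extend (true ∷ S)  a f g eq = cong (g (f zero) +_) (sum-extend S a (f ∘ suc) g eq)
sum-extend (false ∷ S) a f g eq = cong₂ _+_ eq (sum-extend S a f g eq)

induced : (G : Graph) → Subset (size G) → Graph
induced G S = record
  { size   = ∣ S ∣
  ; adj    = λ i j → adj G (embed S i) (embed S j)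
  ; sym    = λ i j → adj-sym G (embed S i) (embed S j)
  ; irrefl = λ i → irrefl G (embed S i)
  }

induced-subgraph : ∀ G S → Subgraph (induced G S) G
induced-subgraph G S = record { emb = embed S ; emb-inj = embed-injective S ; emb-adj = λ _ _ e → e }

weaken-colouring : ∀ {H c d} → c ≤ d → Colouring H c → Colouring H d
weaken-colouring c≤d (col , proper) =
  (λ v → inject≤ (col v) c≤d) , λ u v e eq → proper u v e (inject≤-injective c≤d c≤d _ _ eq)

module _ (G : Graph) (S : Subset (size G)) where

  extend-colouring : ∀ {c} → Colouring (induced G S) (suc c) → ColouringOn G S (suc c)
  extend-colouring (col , proper) = extend S zero col , proper′
    where
    proper′ : ∀ u v → lookup S u ≡ true → lookup S v ≡ true → Edge G u v → extend S zero col u ≢ extend S zero col v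
    proper′ u v u∈S v∈S e eq with embed-surjective S u u∈S | embed-surjective S v v∈S
    ... | i , refl | j , refl = proper i j e
      (trans (sym (extend-embed S zero col i)) (trans eq (extend-embed S zero col j)))

  -- `X` becomes the middle, the rest of the closed set `C` the left side, and everything else the
  -- right side. An edge from left to right would leave `C` outside `X`.
  separation : ∀ {k X} → Disconnects (induced G S) k X → Separation G S k
  separation {k} {X} disc = record
    { part    = extend S right part
    ; order   = subst (_< k) (trans (∣∣≡sum X) (sym (trans (sum-extend S right part isMid refl) (sum-cong-≗ mid-count)))) small
    ; l       = embed S u
    ; r       = embed S v
    ; l∈S     = embed∈ S u
    ; r∈S     = embed∈ S v
    ; l-left  = trans (extend-embed S right part u) u-left
    ; r-right = trans (extend-embed S right part v) v-right
    ; no-edge = no-edge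
    }
    where
    open Disconnects disc
    side : Bool → Bool → Part
    side true  _     = mid
    side false true  = left
    side false false = right
    part : Fin ∣ S ∣ → Part
    part i = side (lookup X i) (C i)
    mid-count : ∀ i → isMid (part i) ≡ ind (lookup X i)
    mid-count i with lookup X i | C i
    ... | true  | _     = refl
    ... | false | true  = refl
    ... | false | false = refl
    u-left : part u ≡ left
    u-left rewrite ∉⇒false u∉X | u∈C = refl
    v-right : part v ≡ right
    v-right rewrite ∉⇒false v∉X | v∉C = refl
    side-left : ∀ a b → side a b ≡ left → b ≡ true
    side-left false true _ = refl
    side-right : ∀ a b → side a b ≡ right → a ≡ false × b ≡ false
    side-right false false _ = refl , refl
    no-edge : ∀ x y → lookup S x ≡ true → lookup S y ≡ true →
      extend S right part x ≡ left → extend S right part y ≡ right → ¬ Edge G x y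
    no-edge x y x∈S y∈S x-left y-right e with embed-surjective S x x∈S | embed-surjective S y y∈S
    ... | i , refl | j , refl
      with side-right (lookup X j) (C j) (trans (sym (extend-embed S right part j)) y-right)
    ...   | j∉X , j∉C = contradiction (trans (sym j∉C)
      (closed i j (side-left (lookup X i) (C i) (trans (sym (extend-embed S right part i)) x-left)) (false⇒∉ j∉X) e)) λ ()

  -- Each way of failing to be good gives an alternative: at most k + 1 vertices can all get
  -- different colours, a small disconnecting set gives a separation, and too small a chromatic
  -- number gives a colouring.
  good⊎split : ∀ k → Good (suc k) G (induced G S) ⊎ (Separation G S (suc k) ⊎ ColouringOn G S (suc k))
  good⊎split k with suc k <? ∣ S ∣
  ... | no  k≮∣S∣ = inj₂ (inj₂ (extend-colouring (weaken-colouring {induced G S} (≮⇒≥ k≮∣S∣)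
                      ((λ v → v) , λ u v e eq → irreflexive u v eq e))))
    where
    irreflexive : ∀ u v → u ≡ v → ¬ Edge (induced G S) u v
    irreflexive u _ refl e = contradiction (trans (sym e) (irrefl G (embed S u))) λ ()
  ... | yes k<∣S∣ with Vec-searchable Bool-searchable (connected⊎disconnects (induced G S) (suc k))
  ...   | inj₂ (X , disc) = inj₂ (inj₁ (separation disc))
  ...   | inj₁ conn with chromatic⊎colouring (induced G S) k
  ...     | inj₁ χ≥k = inj₁ (induced-subgraph G S , inj₂ (k<∣S∣ , conn) , χ≥k)
  ...     | inj₂ col = inj₂ (inj₂ (extend-colouring (weaken-colouring {induced G S} (n≤1+n k) col)))

good⊎all-split : ∀ k G → (∀ S → Separation G S (suc k) ⊎ ColouringOn G S (suc k)) ⊎ ∃ (Good (suc k) G)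
good⊎all-split k G with Vec-searchable Bool-searchable
  (λ S → [ inj₂ , inj₁ ]′ (good⊎split G S k))
... | inj₁ split      = inj₁ split
... | inj₂ (S , good) = inj₂ (induced G S , good)

flip : Part → Part
flip left  = right
flip mid   = mid
flip right = left

isMid-flip : ∀ p → isMid (flip p) ≡ isMid p
isMid-flip left  = refl
isMid-flip mid   = refl
isMid-flip right = refl

flip-left : ∀ p → flip p ≡ left → p ≡ right
flip-left right _ = refl

flip-right : ∀ p → flip p ≡ right → p ≡ left
flip-right left _ = refl

-- Allows the lighter side of a separation to be taken as the right one.
flipSeparation : ∀ {G S k} → Separation G S k → Separation G S k
flipSeparation {G} {k = k} sep = record
  { part    = flip ∘ part
  ; order   = subst (_< k) (sum-cong-≗ (sym ∘ isMid-flip ∘ part)) order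
  ; l       = r
  ; r       = l
  ; l∈S     = r∈S
  ; r∈S     = l∈S
  ; l-left  = cong flip r-right
  ; r-right = cong flip l-left
  ; no-edge = λ u v u∈S v∈S u-left v-right e →
      no-edge v u v∈S u∈S (flip-right _ v-right) (flip-left _ u-left) (trans (adj-sym G v u) e)
  }
  where open Separation sep

onRight : Part → ℕ → ℕ
onRight right w = w
onRight _     _ = 0

-- The colouring procedure

module Colour (G : Graph) (k N : ℕ) (0<k : 0 < k) (N≡7k : N ≡ 7 * k)
  (split : ∀ S → Separation G S k ⊎ ColouringOn G S k) where

  instance
    k-nonZero : NonZero k
    k-nonZero = >-nonZero 0<k

  V : Set
  V = Fin (size G)

  c₀ : Fin N
  c₀ = fromℕ< (≤-trans 0<k (≤-trans (m≤m+n k (6 * k)) (≤-reflexive (sym N≡7k))))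

  -- A partial instance on the fixed vertex set of `G`: a vertex is absent, precoloured, or
  -- uncoloured with a set of forbidden colours. Absent vertices avoid any change of vertex type in
  -- the recursion.
  data Status : Set where
    out   : Status
    fixed : Fin N → Status
    free  : (Fin N → Bool) → Status

  isPresent : Status → Bool
  isPresent out       = false
  isPresent (fixed _) = true
  isPresent (free _)  = true

  FixedTo : Status → Fin N → Set
  FixedTo (fixed d) c = d ≡ c
  FixedTo _         c = ⊥

  IsFree : Status → Set
  IsFree (free _) = ⊤
  IsFree _        = ⊥

  Allows : Status → Fin N → Set
  Allows out       d = ⊤
  Allows (fixed c) d = c ≡ d
  Allows (free F)  d = F d ≡ false

  forbidden : Status → Fin N → Bool
  forbidden (free F) c = F c
  forbidden _        c = false

  forb : Status → Fin N → ℕ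
  forb s = ind ∘ forbidden s

  pin : Status → Fin N → ℕ
  pin (fixed d) c = δ d c
  pin _         c = 0

  weight : Status → ℕ
  weight out       = 0
  weight (fixed _) = k
  weight (free F)  = sum (ind ∘ F)

  -- Termination measure: vertices only move from `free` to `fixed` to `out`, and every recursive
  -- call moves at least one.
  level : Status → ℕ
  level out       = 0
  level (fixed _) = 1
  level (free _)  = 2

  State : Set
  State = V → Status

  Solution : State → Set
  Solution σ = Σ (V → Fin N) λ col →
    (∀ v → Allows (σ v) (col v)) ×
    (∀ u v → isPresent (σ u) ≡ true → isPresent (σ v) ≡ true → Edge G u v → col u ≢ col v)

  record Invariant (σ : State) : Set where
    field
      proper : ∀ u v {c d} → FixedTo (σ u) c → FixedTo (σ v) d → Edge G u v → c ≢ d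
      light  : sum (weight ∘ σ) ≤ 2 * (k * k)
      lists  : ∀ v → sum (forb (σ v)) ≤ k

  no-loop : ∀ v → ¬ Edge G v v
  no-loop v e = contradiction (trans (sym e) (irrefl G v)) λ ()

  edge-sym : ∀ {u v} → Edge G u v → Edge G v u
  edge-sym {u} {v} e = trans (adj-sym G v u) e

  fixed-allows : ∀ s {c} → FixedTo s c → Allows s c
  fixed-allows (fixed _) eq = eq

  pin≡0⇒≢ : ∀ s {d c} → FixedTo s d → pin s c ≡ 0 → d ≢ c
  pin≡0⇒≢ (fixed _) refl = δ≡0⇒≢

  sum-forb≤weight : ∀ s → sum (forb s) ≤ weight s
  sum-forb≤weight out       = ≤-reflexive (sum-zero N)
  sum-forb≤weight (fixed c) = ≤-trans (≤-reflexive (sum-zero N)) z≤n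
  sum-forb≤weight (free F)  = ≤-refl

  k*sum-pin≤weight : ∀ s → k * sum (pin s) ≤ weight s
  k*sum-pin≤weight out       = ≤-reflexive (trans (cong (k *_) (sum-zero N)) (*-zeroʳ k))
  k*sum-pin≤weight (fixed c) = ≤-reflexive (trans (cong (k *_) (sum-δ c)) (*-identityʳ k))
  k*sum-pin≤weight (free F)  = ≤-trans (≤-reflexive (trans (cong (k *_) (sum-zero N)) (*-zeroʳ k))) z≤n

  module _ {σ : State} (inv : Invariant σ) where
    open Invariant inv

    pinned : Fin N → ℕ
    pinned c = sum (λ v → pin (σ v) c)

    -- A precoloured vertex weighs `k`, so total weight 2k² leaves room for at most 2k of them;
    -- summing over the colours counts each one once.
    sum-pinned≤2k : sum pinned ≤ 2 * k
    sum-pinned≤2k = *-cancelˡ-≤ k (begin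
      k * sum pinned                     ≡⟨ cong (k *_) (∑-comm (λ c v → pin (σ v) c)) ⟩
      k * sum (λ v → sum (pin (σ v)))    ≡⟨ *-distribˡ-sum k (λ v → sum (pin (σ v))) ⟩
      sum (λ v → k * sum (pin (σ v)))    ≤⟨ sum-mono-≤ (k*sum-pin≤weight ∘ σ) ⟩
      sum (weight ∘ σ)                   ≤⟨ light ⟩
      2 * (k * k)                        ≡⟨ arith k ⟩
      k * (2 * k)                        ∎)
      where
      open ≤-Reasoning
      arith : ∀ k → 2 * (k * k) ≡ k * (2 * k)
      arith = solve-∀

    pinned≡0⇒≢ : ∀ {v c d} → pinned c ≡ 0 → FixedTo (σ v) d → d ≢ c
    pinned≡0⇒≢ {v} {c} eq fx = pin≡0⇒≢ (σ v) fx
      (n≤0⇒n≡0 (≤-trans (f≤sum (λ w → pin (σ w) c) v) (≤-reflexive eq)))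

  -- At most k colours are forbidden at `v` and at most 2k occur on precoloured vertices, which
  -- leaves a colour among the 7k. A value below 1 says that neither obstacle is present.
  some-colour : ∀ {σ} (inv : Invariant σ) v → ∃ λ c → forb (σ v) c + pinned inv c < 1
  some-colour {σ} inv v = sum-<⇒∃< (λ c → forb (σ v) c + pinned inv c) (λ _ → 1) (begin-strict
    sum (λ c → forb (σ v) c + pinned inv c)   ≡⟨ ∑-distrib-+ (forb (σ v)) (pinned inv) ⟩
    sum (forb (σ v)) + sum (pinned inv)       ≤⟨ +-mono-≤ (Invariant.lists inv v) (sum-pinned≤2k inv) ⟩
    k + 2 * k                                 <⟨ m<m+n _ (≤-trans 0<k (m≤m+n k (3 * k))) ⟩
    (k + 2 * k) + 4 * k                       ≡⟨ arith k ⟩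
    7 * k * 1                                 ≡⟨ cong (_* 1) N≡7k ⟨
    N * 1                                     ≡⟨ sum-const N 1 ⟨
    sum {N} (λ _ → 1)                         ∎)
    where
    open ≤-Reasoning
    arith : ∀ k → (k + 2 * k) + 4 * k ≡ 7 * k * 1
    arith = solve-∀

  -- Precolouring a vertex whose list of forbidden colours is full

  module FixStep {σ : State} (inv : Invariant σ) (v : V) (full : k ≤ sum (forb (σ v)))
    (c : Fin N) (c-available : forb (σ v) c + pinned inv c < 1) where
    open Invariant inv

    unforbidden : forb (σ v) c ≡ 0
    unforbidden = n<1⇒n≡0 (≤-<-trans (m≤m+n _ _) c-available)

    unpinned : pinned inv c ≡ 0
    unpinned = n<1⇒n≡0 (≤-<-trans (m≤n+m _ _) c-available)

    σ′ : State
    σ′ w with v ≟ w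
    ... | yes _ = fixed c
    ... | no  _ = σ w

    -- Since k is positive, a full list is nonempty, and only free vertices have nonempty lists.
    forb-free : ∀ s → k ≤ sum (forb s) → IsFree s
    forb-free out       le = contradiction (≤-trans (≤-trans 0<k le) (≤-reflexive (sum-zero N))) λ ()
    forb-free (fixed _) le = contradiction (≤-trans (≤-trans 0<k le) (≤-reflexive (sum-zero N))) λ ()
    forb-free (free _)  le = tt

    fixed-level : ∀ s → IsFree s → 1 < level s
    fixed-level (free _) _ = ≤-refl

    forb≡0⇒allows : ∀ s → IsFree s → forb s c ≡ 0 → Allows s c
    forb≡0⇒allows (free F) _ eq with F c
    ... | false = refl

    v-free : IsFree (σ v)
    v-free = forb-free (σ v) full

    σ′-fixed : ∀ u {a} → FixedTo (σ′ u) a → (v ≡ u × c ≡ a) ⊎ FixedTo (σ u) a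
    σ′-fixed u fx with v ≟ u
    ... | yes eq = inj₁ (eq , fx)
    ... | no  _  = inj₂ fx

    invariant : Invariant σ′
    invariant = record { proper = proper′ ; light = ≤-trans (sum-mono-≤ weight′) light ; lists = lists′ }
      where
      proper′ : ∀ u w {a b} → FixedTo (σ′ u) a → FixedTo (σ′ w) b → Edge G u w → a ≢ b
      proper′ u w fu fw e with σ′-fixed u fu | σ′-fixed w fw
      ... | inj₁ (refl , refl) | inj₁ (refl , refl) = contradiction e (no-loop v)
      ... | inj₁ (refl , refl) | inj₂ fw′           = pinned≡0⇒≢ inv {w} unpinned fw′ ∘ sym
      ... | inj₂ fu′           | inj₁ (refl , refl) = pinned≡0⇒≢ inv {u} unpinned fu′
      ... | inj₂ fu′           | inj₂ fw′           = proper u w fu′ fw′ e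
      weight′ : ∀ w → weight (σ′ w) ≤ weight (σ w)
      weight′ w with v ≟ w
      -- The full list already weighed at least `k`, the weight of a precoloured vertex.
      ... | yes refl = ≤-trans full (sum-forb≤weight (σ v))
      ... | no  _    = ≤-refl
      lists′ : ∀ w → sum (forb (σ′ w)) ≤ k
      lists′ w with v ≟ w
      ... | yes _ = ≤-trans (≤-reflexive (sum-zero N)) z≤n
      ... | no  _ = lists w

    smaller : sum (level ∘ σ′) < sum (level ∘ σ)
    smaller = sum-mono-< below v strict
      where
      below : ∀ w → level (σ′ w) ≤ level (σ w)
      below w with v ≟ w
      ... | yes refl = <⇒≤ (fixed-level (σ v) v-free)
      ... | no  _    = ≤-refl
      strict : level (σ′ v) < level (σ v)
      strict with v ≟ v
      ... | yes _  = fixed-level (σ v) v-free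
      ... | no  ¬p = contradiction refl ¬p

    solution : Solution σ′ → Solution σ
    solution (col , allows , proper) = col , allows′ , λ u w pu pw → proper u w (present u pu) (present w pw)
      where
      allows′ : ∀ w → Allows (σ w) (col w)
      allows′ w with v ≟ w | allows w
      ... | no  _    | a = a
      ... | yes refl | a = subst (Allows (σ v)) a (forb≡0⇒allows (σ v) v-free unforbidden)
      present : ∀ w → isPresent (σ w) ≡ true → isPresent (σ′ w) ≡ true
      present w pw with v ≟ w
      ... | yes _ = refl
      ... | no  _ = pw

  freeNbr : Bool → Status → ℕ
  freeNbr true (free _) = 1
  freeNbr _    _        = 0

  -- Only free neighbours count: they are the ones whose lists grow when `x` is deleted.
  degree : State → V → ℕ
  degree σ x = sum (λ v → freeNbr (adj G x v) (σ v))

  -- Deleting a precoloured vertex with few uncoloured neighbours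

  module DeleteStep {σ : State} (inv : Invariant σ) (short : ∀ v → sum (forb (σ v)) < k)
    (x : V) (c : Fin N) (x-fixed : FixedTo (σ x) c) (sparse : degree σ x ≤ k) where
    open Invariant inv

    forbid : Bool → Status → Status
    forbid true (free F) = free λ d → F d ∨ does (c ≟ d)
    forbid _    s        = s

    σ′ : State
    σ′ w with x ≟ w
    ... | yes _ = out
    ... | no  _ = forbid (adj G x w) (σ w)

    weight-forbid : ∀ a s → weight (forbid a s) ≤ weight s + freeNbr a s
    weight-forbid true  (free F)  = sum-∨-≟ F c
    weight-forbid false (free F)  = m≤m+n _ _
    weight-forbid true  out       = m≤m+n _ _
    weight-forbid false out       = m≤m+n _ _
    weight-forbid true  (fixed _) = m≤m+n _ _
    weight-forbid false (fixed _) = m≤m+n _ _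

    -- Full lists have been removed beforehand, so every list has room for one more colour.
    forb-forbid : ∀ a s → sum (forb s) < k → sum (forb (forbid a s)) ≤ k
    forb-forbid true  (free F)  lt = ≤-trans (sum-∨-≟ F c) (≤-trans (≤-reflexive (+-comm _ 1)) lt)
    forb-forbid false (free F)  lt = <⇒≤ lt
    forb-forbid true  out       lt = <⇒≤ lt
    forb-forbid false out       lt = <⇒≤ lt
    forb-forbid true  (fixed _) lt = <⇒≤ lt
    forb-forbid false (fixed _) lt = <⇒≤ lt

    fixed-forbid : ∀ a s {d} → FixedTo (forbid a s) d → FixedTo s d
    fixed-forbid true  (fixed _) fx = fx
    fixed-forbid false (fixed _) fx = fx

    level-forbid : ∀ a s → level (forbid a s) ≤ level s
    level-forbid true  (free F)  = ≤-refl
    level-forbid false (free F)  = ≤-refl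
    level-forbid true  out       = ≤-refl
    level-forbid false out       = ≤-refl
    level-forbid true  (fixed _) = ≤-refl
    level-forbid false (fixed _) = ≤-refl

    present-forbid : ∀ a s → isPresent s ≡ true → isPresent (forbid a s) ≡ true
    present-forbid true  (free F)  _ = refl
    present-forbid false (free F)  _ = refl
    present-forbid true  (fixed _) _ = refl
    present-forbid false (fixed _) _ = refl

    allows-forbid : ∀ a s {d} → Allows (forbid a s) d → Allows s d
    allows-forbid true  (free F) {d} al with F d
    ... | false = refl
    allows-forbid false (free F)  al = al
    allows-forbid true  out       al = al
    allows-forbid false out       al = al
    allows-forbid true  (fixed _) al = al
    allows-forbid false (fixed _) al = al

    fixed-level : ∀ s → FixedTo s c → 0 < level s
    fixed-level (fixed _) _ = z<s

    fixed-weight : ∀ s → FixedTo s c → k ≤ weight s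
    fixed-weight (fixed _) _ = ≤-refl

    σ′-fixed : ∀ u {a} → FixedTo (σ′ u) a → FixedTo (σ u) a
    σ′-fixed u fx with x ≟ u
    ... | no _ = fixed-forbid (adj G x u) (σ u) fx

    invariant : Invariant σ′
    invariant = record
      { proper = λ u w fu fw → proper u w (σ′-fixed u fu) (σ′-fixed w fw)
      ; light  = +-cancelʳ-≤ k _ _ light′
      ; lists  = lists′
      }
      where
      -- The weight `k` released at `x` is added on the left instead of being subtracted on the
      -- right. Summation then compares it with the number of lists that grow.
      pointwise : ∀ w → weight (σ′ w) + k * δ x w ≤ weight (σ w) + freeNbr (adj G x w) (σ w)
      pointwise w with x ≟ w
      ... | yes refl = ≤-trans (≤-reflexive (trans (cong (k *_) (δ-refl x)) (*-identityʳ k)))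
                         (≤-trans (fixed-weight (σ x) x-fixed) (m≤m+n _ _))
      ... | no x≢w   = ≤-trans (≤-reflexive (trans (cong (weight (forbid (adj G x w) (σ w)) +_)
                         (trans (cong (k *_) (≢⇒δ≡0 x≢w)) (*-zeroʳ k))) (+-identityʳ _)))
                         (weight-forbid (adj G x w) (σ w))
      open ≤-Reasoning
      light′ : sum (weight ∘ σ′) + k ≤ 2 * (k * k) + k
      light′ = begin
        sum (weight ∘ σ′) + k                                    ≡⟨ cong (sum (weight ∘ σ′) +_) (trans (cong (k *_) (sum-δ x)) (*-identityʳ k)) ⟨
        sum (weight ∘ σ′) + k * sum (δ x)                        ≡⟨ cong (sum (weight ∘ σ′) +_) (*-distribˡ-sum k (δ x)) ⟩
        sum (weight ∘ σ′) + sum (λ w → k * δ x w)                ≡⟨ ∑-distrib-+ (weight ∘ σ′) (λ w → k * δ x w) ⟨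
        sum (λ w → weight (σ′ w) + k * δ x w)                    ≤⟨ sum-mono-≤ pointwise ⟩
        sum (λ w → weight (σ w) + freeNbr (adj G x w) (σ w))     ≡⟨ ∑-distrib-+ (weight ∘ σ) (λ w → freeNbr (adj G x w) (σ w)) ⟩
        sum (weight ∘ σ) + degree σ x                            ≤⟨ +-mono-≤ light sparse ⟩
        2 * (k * k) + k                                          ∎
      lists′ : ∀ w → sum (forb (σ′ w)) ≤ k
      lists′ w with x ≟ w
      ... | yes _ = ≤-trans (≤-reflexive (sum-zero N)) z≤n
      ... | no  _ = forb-forbid (adj G x w) (σ w) (short w)

    smaller : sum (level ∘ σ′) < sum (level ∘ σ)
    smaller = sum-mono-< below x strict
      where
      below : ∀ w → level (σ′ w) ≤ level (σ w)
      below w with x ≟ w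
      ... | yes _ = z≤n
      ... | no  _ = level-forbid (adj G x w) (σ w)
      strict : level (σ′ x) < level (σ x)
      strict with x ≟ x
      ... | yes _  = fixed-level (σ x) x-fixed
      ... | no  ¬p = contradiction refl ¬p

    solution : Solution σ′ → Solution σ
    solution (col , allows , proper-col) = col′ , allows′ , proper′
      where
      col′ : V → Fin N
      col′ w with x ≟ w
      ... | yes _ = c
      ... | no  _ = col w
      allows′ : ∀ w → Allows (σ w) (col′ w)
      allows′ w with x ≟ w | allows w
      ... | yes refl | _ = fixed-allows (σ x) x-fixed
      ... | no  _    | a = allows-forbid (adj G x w) (σ w) a
      -- A precoloured neighbour of `x` differs from `c` by the invariant, a free one because `c`
      -- was added to its list.
      c≢ : ∀ w a s {d} → σ w ≡ s → Edge G x w → a ≡ true → isPresent s ≡ true → Allows (forbid a s) d → c ≢ d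
      c≢ w true (fixed b) eq e _ _ refl = proper x w x-fixed (subst (λ s → FixedTo s b) (sym eq) refl) e
      c≢ w true (free F) {d} eq e _ _ al c≡d with F d | c ≟ d
      ... | false | no c≢d = c≢d c≡d
      proper′ : ∀ u w → isPresent (σ u) ≡ true → isPresent (σ w) ≡ true → Edge G u w → col′ u ≢ col′ w
      proper′ u w pu pw e with x ≟ u | x ≟ w | allows u | allows w | proper-col u w
      ... | yes refl | yes refl | _ | _ | _ = contradiction e (no-loop x)
      ... | yes refl | no _     | _ | a | _ = c≢ w (adj G x w) (σ w) refl e e pw a
      ... | no _     | yes refl | a | _ | _ = c≢ u (adj G x u) (σ u) refl (edge-sym e) (edge-sym e) pu a ∘ sym
      ... | no _     | no _     | _ | _ | p = p (present-forbid (adj G x u) (σ u) pu) (present-forbid (adj G x w) (σ w) pw) e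

  presentSet : State → Subset (size G)
  presentSet σ = tabulate (isPresent ∘ σ)

  ∈presentSet : ∀ σ v → isPresent (σ v) ≡ true → lookup (presentSet σ) v ≡ true
  ∈presentSet σ v p = trans (lookup∘tabulate (isPresent ∘ σ) v) p

  presentSet∋ : ∀ σ v → lookup (presentSet σ) v ≡ true → isPresent (σ v) ≡ true
  presentSet∋ σ v p = trans (sym (lookup∘tabulate (isPresent ∘ σ) v)) p

  -- Colouring an instance whose underlying graph has `k` colour classes

  module ColourStep {σ : State} (inv : Invariant σ) (κ : V → Fin k)
    (κ-proper : ∀ u v → isPresent (σ u) ≡ true → isPresent (σ v) ≡ true → Edge G u v → κ u ≢ κ v) where
    open Invariant inv

    classForb : Fin k → Fin N → ℕ
    classForb i c = sum (λ v → δ (κ v) i * forb (σ v) c)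

    classTotal : Fin k → ℕ
    classTotal i = sum (λ v → δ (κ v) i * sum (forb (σ v)))

    sum-classForb : ∀ i → sum (classForb i) ≡ classTotal i
    sum-classForb i = trans (∑-comm (λ c v → δ (κ v) i * forb (σ v) c))
      (sum-cong-≗ (λ v → sym (*-distribˡ-sum (δ (κ v) i) (forb (σ v)))))

    sum-classTotal : sum classTotal ≡ sum (λ v → sum (forb (σ v)))
    sum-classTotal = trans (∑-comm (λ i v → δ (κ v) i * sum (forb (σ v))))
      (sum-cong-≗ (λ v → sum-δ-* (κ v) (λ _ → sum (forb (σ v)))))

    -- One inequality, cost below `suc (classTotal i)`, encodes two demands. A colour on a
    -- precoloured vertex alone costs that much, so it is excluded; and 4k times the number of
    -- vertices of class `i` forbidding `c` is at most `classTotal i`.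
    cost : Fin k → Fin N → ℕ
    cost i c = 4 * k * classForb i c + suc (classTotal i) * pinned inv c

    -- With t the total list length of the class, forbidden colours cost 4kt, pinned ones at most
    -- 2k(1 + t), and distinctness of the class colours k(1 + t). The sum falls short of 7k(1 + t)
    -- by at least 4k.
    cost-small : ∀ i → true ≡ true → sum (cost i) + sum {k} (λ _ → 1) * suc (classTotal i) < N * suc (classTotal i)
    cost-small i _ = begin-strict
      sum (cost i) + sum {k} (λ _ → 1) * suc t
        ≡⟨ cong₂ _+_ (∑-distrib-+ (λ c → 4 * k * classForb i c) (λ c → suc t * pinned inv c)) (cong (_* suc t) (sum-const k 1)) ⟩
      (sum (λ c → 4 * k * classForb i c) + sum (λ c → suc t * pinned inv c)) + k * 1 * suc t
        ≡⟨ cong (_+ k * 1 * suc t) (cong₂ _+_ (*-distribˡ-sum (4 * k) (classForb i)) (*-distribˡ-sum (suc t) (pinned inv))) ⟨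
      (4 * k * sum (classForb i) + suc t * sum (pinned inv)) + k * 1 * suc t
        ≤⟨ +-monoˡ-≤ (k * 1 * suc t) (+-mono-≤ (≤-reflexive (cong (4 * k *_) (sum-classForb i))) (*-monoʳ-≤ (suc t) (sum-pinned≤2k inv))) ⟩
      (4 * k * t + suc t * (2 * k)) + k * 1 * suc t
        <⟨ m<m+n _ (≤-trans 0<k (m≤m+n k (3 * k))) ⟩
      ((4 * k * t + suc t * (2 * k)) + k * 1 * suc t) + 4 * k
        ≡⟨ arith k t ⟩
      7 * k * suc t
        ≡⟨ cong (_* suc t) N≡7k ⟨
      N * suc t ∎
      where
      open ≤-Reasoning
      t = classTotal i
      arith : ∀ k t → ((4 * k * t + (1 + t) * (2 * k)) + k * 1 * (1 + t)) + 4 * k ≡ 7 * k * (1 + t)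
      arith = solve-∀

    classColours : ∃ λ (s : Fin k → Fin N) →
      (∀ i → true ≡ true → cost i (s i) < suc (classTotal i)) ×
      (∀ i j → true ≡ true → true ≡ true → s i ≡ s j → i ≡ j)
    classColours = distinctChoice c₀ k (λ _ → true) (suc ∘ classTotal) cost cost-small

    module Repair (s : Fin k → Fin N) (s-cheap : ∀ i → cost i (s i) < suc (classTotal i))
      (s-inj : ∀ i j → s i ≡ s j → i ≡ j) where

      s-unpinned : ∀ i → pinned inv (s i) ≡ 0
      s-unpinned i = n<1⇒n≡0 (*-cancelˡ-< (suc (classTotal i)) _ _
        (<-≤-trans (≤-<-trans (m≤n+m _ (4 * k * classForb i (s i))) (s-cheap i)) (≤-reflexive (sym (*-identityʳ _)))))

      s-saves : ∀ i → 4 * k * classForb i (s i) ≤ classTotal i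
      s-saves i = ≤-pred (≤-<-trans (m≤m+n _ _) (s-cheap i))

      bad : V → Bool
      bad v = forbidden (σ v) (s (κ v))

      -- Summing `s-saves` over the classes bounds 4k times the number of bad vertices by the total
      -- weight, hence by 2k², which is at most 4k².
      few-bad : sum (ind ∘ bad) ≤ k
      few-bad = *-cancelˡ-≤ (4 * k) {{m*n≢0 4 k}} (begin
        4 * k * sum (ind ∘ bad)
          ≡⟨ cong (4 * k *_) (sum-cong-≗ (λ v → sym (sum-δ-* (κ v) (λ i → forb (σ v) (s i))))) ⟩
        4 * k * sum (λ v → sum (λ i → δ (κ v) i * forb (σ v) (s i)))
          ≡⟨ cong (4 * k *_) (∑-comm (λ v i → δ (κ v) i * forb (σ v) (s i))) ⟩
        4 * k * sum (λ i → classForb i (s i))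
          ≡⟨ *-distribˡ-sum (4 * k) (λ i → classForb i (s i)) ⟩
        sum (λ i → 4 * k * classForb i (s i))
          ≤⟨ sum-mono-≤ s-saves ⟩
        sum classTotal
          ≡⟨ sum-classTotal ⟩
        sum (λ v → sum (forb (σ v)))
          ≤⟨ sum-mono-≤ (sum-forb≤weight ∘ σ) ⟩
        sum (weight ∘ σ)
          ≤⟨ light ⟩
        2 * (k * k)
          ≤⟨ m≤m+n _ (2 * (k * k)) ⟩
        2 * (k * k) + 2 * (k * k)
          ≡⟨ arith k ⟩
        4 * k * k ∎)
        where
        open ≤-Reasoning
        arith : ∀ k → 2 * (k * k) + 2 * (k * k) ≡ 4 * k * k
        arith = solve-∀

      used : Fin N → ℕ
      used c = sum (λ i → δ (s i) c)

      sum-used : sum used ≡ k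
      sum-used = trans (∑-comm (λ c i → δ (s i) c))
        (trans (sum-cong-≗ (λ i → sum-δ (s i))) (trans (sum-const k 1) (*-identityʳ k)))

      blocked : V → Fin N → ℕ
      blocked v c = (forb (σ v) c + pinned inv c) + used c

      -- A new colour must avoid at most k forbidden colours, 2k pinned ones, the k class colours
      -- and a reserve of k for the bad vertices: 5k in all, out of 7k.
      blocked-small : ∀ v → bad v ≡ true → sum (blocked v) + sum (ind ∘ bad) * 1 < N * 1
      blocked-small v _ = begin-strict
        sum (blocked v) + sum (ind ∘ bad) * 1
          ≡⟨ cong (_+ sum (ind ∘ bad) * 1) (trans (∑-distrib-+ (λ c → forb (σ v) c + pinned inv c) used)
               (cong₂ _+_ (∑-distrib-+ (forb (σ v)) (pinned inv)) sum-used)) ⟩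
        ((sum (forb (σ v)) + sum (pinned inv)) + k) + sum (ind ∘ bad) * 1
          ≤⟨ +-mono-≤ (+-monoˡ-≤ k (+-mono-≤ (lists v) (sum-pinned≤2k inv))) (*-monoˡ-≤ 1 few-bad) ⟩
        ((k + 2 * k) + k) + k * 1
          <⟨ m<m+n _ (≤-trans 0<k (m≤m+n k (1 * k))) ⟩
        (((k + 2 * k) + k) + k * 1) + 2 * k
          ≡⟨ arith k ⟩
        7 * k * 1
          ≡⟨ cong (_* 1) N≡7k ⟨
        N * 1 ∎
        where
        open ≤-Reasoning
        arith : ∀ k → (((k + 2 * k) + k) + k * 1) + 2 * k ≡ 7 * k * 1
        arith = solve-∀

      repairColours : ∃ λ (ρ : V → Fin N) →
        (∀ v → bad v ≡ true → blocked v (ρ v) < 1) ×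
        (∀ u v → bad u ≡ true → bad v ≡ true → ρ u ≡ ρ v → u ≡ v)
      repairColours = distinctChoice c₀ (size G) bad (λ _ → 1) blocked blocked-small

      module _ (ρ : V → Fin N) (ρ-open : ∀ v → bad v ≡ true → blocked v (ρ v) < 1)
        (ρ-inj : ∀ u v → bad u ≡ true → bad v ≡ true → ρ u ≡ ρ v → u ≡ v) where

        ρ-allowed : ∀ v → bad v ≡ true → forb (σ v) (ρ v) ≡ 0
        ρ-allowed v b = n<1⇒n≡0 (≤-<-trans (≤-trans (m≤m+n _ _) (m≤m+n _ _)) (ρ-open v b))

        ρ-unpinned : ∀ v → bad v ≡ true → pinned inv (ρ v) ≡ 0
        ρ-unpinned v b = n<1⇒n≡0 (≤-<-trans (≤-trans (m≤n+m _ (forb (σ v) (ρ v))) (m≤m+n _ (used (ρ v)))) (ρ-open v b))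

        ρ-unused : ∀ v → bad v ≡ true → ∀ i → s i ≢ ρ v
        ρ-unused v b i = δ≡0⇒≢ (n<1⇒n≡0 (≤-<-trans
          (≤-trans (f≤sum (λ j → δ (s j) (ρ v)) i) (m≤n+m _ _)) (ρ-open v b)))

        -- Status and badness are explicit arguments so that they can be replaced along equations in
        -- `kind` and `allowed`.
        colour : Status → Bool → Fin N → Fin N → Fin N
        colour out       _     _ _ = c₀
        colour (fixed c) _     _ _ = c
        colour (free _)  true  r _ = r
        colour (free _)  false _ d = d

        col : V → Fin N
        col v = colour (σ v) (bad v) (ρ v) (s (κ v))

        data Kind (v : V) : Set where
          pre  : FixedTo (σ v) (col v) → Kind v
          kept : col v ≡ s (κ v) → Kind v
          redo : bad v ≡ true → col v ≡ ρ v → Kind v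

        kind : ∀ v → isPresent (σ v) ≡ true → Kind v
        kind v p = go (σ v) (bad v) refl refl p
          where
          go : ∀ t b → σ v ≡ t → bad v ≡ b → isPresent t ≡ true → Kind v
          go (fixed c) b eq eb _ = pre (subst (λ t → FixedTo t (colour t (bad v) (ρ v) (s (κ v)))) (sym eq) refl)
          go (free F) true  eq eb _ = redo eb (cong₂ (λ t b → colour t b (ρ v) (s (κ v))) eq eb)
          go (free F) false eq eb _ = kept (cong₂ (λ t b → colour t b (ρ v) (s (κ v))) eq eb)

        ind≡0 : ∀ b → ind b ≡ 0 → b ≡ false
        ind≡0 false _ = refl

        allowed : ∀ v t b → σ v ≡ t → bad v ≡ b → Allows t (colour t b (ρ v) (s (κ v)))
        allowed v out       b     eq eb = tt
        allowed v (fixed _) b     eq eb = refl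
        allowed v (free F)  true  eq eb = ind≡0 (F (ρ v)) (trans (cong (λ t → forb t (ρ v)) (sym eq)) (ρ-allowed v eb))
        allowed v (free F)  false eq eb = trans (cong (λ t → forbidden t (s (κ v))) (sym eq)) eb

        -- A colour comes from the precolouring, from a class, or from the recolouring. Different
        -- origins give different colours by the choices of `s` and `ρ`; within one origin, the
        -- invariant, `κ-proper` with injectivity of `s`, or injectivity of `ρ` decides.
        col-proper : ∀ u v → isPresent (σ u) ≡ true → isPresent (σ v) ≡ true → Edge G u v → col u ≢ col v
        col-proper u v pu pv e eq with kind u pu | kind v pv
        ... | pre fu    | pre fv    = proper u v fu fv e eq
        ... | pre fu    | kept ev   = pinned≡0⇒≢ inv {u} (s-unpinned (κ v)) fu (trans eq ev)
        ... | pre fu    | redo b ev = pinned≡0⇒≢ inv {u} (ρ-unpinned v b) fu (trans eq ev)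
        ... | kept eu   | pre fv    = pinned≡0⇒≢ inv {v} (s-unpinned (κ u)) fv (trans (sym eq) eu)
        ... | redo b eu | pre fv    = pinned≡0⇒≢ inv {v} (ρ-unpinned u b) fv (trans (sym eq) eu)
        ... | kept eu   | kept ev   = κ-proper u v pu pv e (s-inj _ _ (trans (sym eu) (trans eq ev)))
        ... | kept eu   | redo b ev = ρ-unused v b (κ u) (trans (sym eu) (trans eq ev))
        ... | redo b eu | kept ev   = ρ-unused u b (κ v) (trans (sym ev) (trans (sym eq) eu))
        ... | redo b eu | redo d ev with ρ-inj u v b d (trans (sym eu) (trans eq ev))
        ...   | refl = no-loop u e

        repaired : Solution σ
        repaired = col , (λ v → allowed v (σ v) (bad v) refl refl) , col-proper

    solution : Solution σ
    solution = let s , s-cheap , s-inj = classColours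
                   open Repair s (λ i → s-cheap i refl) (λ i j → s-inj i j refl refl)
                   ρ , ρ-open , ρ-inj = repairColours
               in repaired ρ ρ-open ρ-inj

  -- Splitting an instance along a separation

  free-on-right : ∀ {σ} → (∀ x c → FixedTo (σ x) c → k < degree σ x) →
    (sep : Separation G (presentSet σ) k) → ∃ λ v → IsFree (σ v) × Separation.part sep v ≡ right
  free-on-right {σ} rich sep = go (σ r) refl (presentSet∋ σ r r∈S)
    where
    open Separation sep
    inspect : ∀ v a t p → adj G r v ≡ a → σ v ≡ t → part v ≡ p → isMid p < freeNbr a t → IsFree t × p ≡ right
    inspect v true (free F) right _  _  _  _  = tt , refl
    inspect v true (free F) left  ea et ep lt = contradiction (trans (adj-sym G v r) ea)
      (no-edge v r (∈presentSet σ v (cong isPresent et)) r∈S ep r-right)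
    inspect v true (free F) mid   ea et ep (s≤s ())
    go : ∀ t → σ r ≡ t → isPresent t ≡ true → ∃ λ v → IsFree (σ v) × part v ≡ right
    go (free F)  eq _ = r , subst IsFree (sym eq) tt , r-right
    -- A precoloured `r` has more than k free neighbours, while fewer than k vertices are in the
    -- middle. So some free neighbour lies outside the middle, and it is not on the left because no
    -- edge joins left to right.
    go (fixed c) eq _ =
      let v , lt = sum-<⇒∃< (isMid ∘ part) (λ v → freeNbr (adj G r v) (σ v))
                     (<-trans order (rich r c (subst (λ t → FixedTo t c) (sym eq) refl)))
      in v , inspect v (adj G r v) (σ v) (part v) refl refl refl lt

  module SeparateStep {σ : State} (inv : Invariant σ) (sep : Separation G (presentSet σ) k)
    (light-right : sum (λ v → onRight (Separation.part sep v) (weight (σ v))) ≤ k * k)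
    (x : V) (x-free : IsFree (σ x)) (x-right : Separation.part sep x ≡ right) where
    open Invariant inv
    open Separation sep

    -- The precoloured vertices of the right side stay, so that the colouring found
    -- for the middle is compatible with them.
    dropRight : Part → Status → Status
    dropRight right (free _) = out
    dropRight _     t        = t

    σ₁ : State
    σ₁ v = dropRight (part v) (σ v)

    -- The graph of `dropRight` as a relation, so that later case analyses have two cases rather
    -- than one for each part and status.
    data Dropped : Part → Status → Status → Set where
      gone : ∀ {F} → Dropped right (free F) out
      same : ∀ {p t} → Dropped p t t

    dropped : ∀ p t → Dropped p t (dropRight p t)
    dropped right (free _)  = gone
    dropped right out       = same
    dropped right (fixed _) = same
    dropped left  t         = same
    dropped mid   t         = same

    fixed-dropped : ∀ {p t t′ c} → Dropped p t t′ → FixedTo t′ c → FixedTo t c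
    fixed-dropped same fx = fx

    weight-dropped : ∀ {p t t′} → Dropped p t t′ → weight t′ ≤ weight t
    weight-dropped gone = z≤n
    weight-dropped same = ≤-refl

    forb-dropped : ∀ {p t t′} → Dropped p t t′ → sum (forb t) ≤ k → sum (forb t′) ≤ k
    forb-dropped gone _  = ≤-trans (≤-reflexive (sum-zero N)) z≤n
    forb-dropped same le = le

    level-dropped : ∀ {p t t′} → Dropped p t t′ → level t′ ≤ level t
    level-dropped gone = z≤n
    level-dropped same = ≤-refl

    level-gone : ∀ p t → p ≡ right → IsFree t → level (dropRight p t) < level t
    level-gone right (free _) _ _ = z<s

    invariant₁ : Invariant σ₁
    invariant₁ = record
      { proper = λ u v fu fv → proper u v (fixed-dropped (dropped (part u) (σ u)) fu) (fixed-dropped (dropped (part v) (σ v)) fv)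
      ; light  = ≤-trans (sum-mono-≤ (λ v → weight-dropped (dropped (part v) (σ v)))) light
      ; lists  = λ v → forb-dropped (dropped (part v) (σ v)) (lists v)
      }

    -- Precoloured vertices of the right side remain, so the decrease comes from the free vertex `x`
    -- there.
    smaller₁ : sum (level ∘ σ₁) < sum (level ∘ σ)
    smaller₁ = sum-mono-< (λ v → level-dropped (dropped (part v) (σ v))) x (level-gone (part x) (σ x) x-right x-free)

    module _ (col₁ : V → Fin N) (allows₁ : ∀ v → Allows (σ₁ v) (col₁ v))
      (proper₁ : ∀ u v → isPresent (σ₁ u) ≡ true → isPresent (σ₁ v) ≡ true → Edge G u v → col₁ u ≢ col₁ v) where

      fixMid : Part → Fin N → Status → Status
      fixMid left  c t   = out
      fixMid mid   c out = out
      fixMid mid   c t   = fixed c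
      fixMid right c t   = t

      σ₂ : State
      σ₂ v = fixMid (part v) (col₁ v) (σ v)

      -- Every vertex precoloured in the second instance took part in the first one and received the
      -- same colour there. Properness of the new precolouring is thus inherited from `proper₁`.
      fixed₁ : ∀ p t c {d} → Allows (dropRight p t) c → FixedTo (fixMid p c t) d →
        isPresent (dropRight p t) ≡ true × c ≡ d
      fixed₁ mid   (fixed _) c al fx   = refl , fx
      fixed₁ mid   (free _)  c al fx   = refl , fx
      fixed₁ right (fixed _) c al refl = refl , sym al

      weight₂ : ∀ p t c → weight (fixMid p c t) ≤ onRight p (weight t) + k * isMid p
      weight₂ left  t         c = z≤n
      weight₂ mid   out       c = z≤n
      weight₂ mid   (fixed _) c = ≤-reflexive (sym (*-identityʳ k))
      weight₂ mid   (free _)  c = ≤-reflexive (sym (*-identityʳ k))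
      weight₂ right t         c = m≤m+n _ _

      forb₂ : ∀ p t c → sum (forb t) ≤ k → sum (forb (fixMid p c t)) ≤ k
      forb₂ left  t         c le = ≤-trans (≤-reflexive (sum-zero N)) z≤n
      forb₂ mid   out       c le = ≤-trans (≤-reflexive (sum-zero N)) z≤n
      forb₂ mid   (fixed _) c le = ≤-trans (≤-reflexive (sum-zero N)) z≤n
      forb₂ mid   (free _)  c le = ≤-trans (≤-reflexive (sum-zero N)) z≤n
      forb₂ right t         c le = le

      level₂ : ∀ p t c → level (fixMid p c t) ≤ level t
      level₂ left  t         c = z≤n
      level₂ mid   out       c = z≤n
      level₂ mid   (fixed _) c = ≤-refl
      level₂ mid   (free _)  c = s≤s z≤n
      level₂ right t         c = ≤-refl

      level-left : ∀ p t c → p ≡ left → isPresent t ≡ true → level (fixMid p c t) < level t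
      level-left left (fixed _) c _ _ = z<s
      level-left left (free _)  c _ _ = z<s

      invariant₂ : Invariant σ₂
      invariant₂ = record
        { proper = proper₂
        ; light  = light₂
        ; lists  = λ v → forb₂ (part v) (σ v) (col₁ v) (lists v)
        }
        where
        proper₂ : ∀ u v {c d} → FixedTo (σ₂ u) c → FixedTo (σ₂ v) d → Edge G u v → c ≢ d
        proper₂ u v fu fv e with fixed₁ (part u) (σ u) (col₁ u) (allows₁ u) fu | fixed₁ (part v) (σ v) (col₁ v) (allows₁ v) fv
        ... | pu , refl | pv , refl = proper₁ u v pu pv e
        open ≤-Reasoning
        light₂ : sum (weight ∘ σ₂) ≤ 2 * (k * k)
        light₂ = begin
          sum (weight ∘ σ₂)
            ≤⟨ sum-mono-≤ (λ v → weight₂ (part v) (σ v) (col₁ v)) ⟩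
          sum (λ v → onRight (part v) (weight (σ v)) + k * isMid (part v))
            ≡⟨ ∑-distrib-+ (λ v → onRight (part v) (weight (σ v))) (λ v → k * isMid (part v)) ⟩
          sum (λ v → onRight (part v) (weight (σ v))) + sum (λ v → k * isMid (part v))
            ≡⟨ cong (sum (λ v → onRight (part v) (weight (σ v))) +_) (*-distribˡ-sum k (isMid ∘ part)) ⟨
          sum (λ v → onRight (part v) (weight (σ v))) + k * sum (isMid ∘ part)
            -- The right side weighs at most k², and fewer than k middle vertices weigh k each.
            ≤⟨ +-mono-≤ light-right (*-monoʳ-≤ k (<⇒≤ order)) ⟩
          k * k + k * k
            ≡⟨ cong (k * k +_) (+-identityʳ (k * k)) ⟨
          2 * (k * k) ∎

      -- The left side disappears, and it contains the present vertex `l`.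
      smaller₂ : sum (level ∘ σ₂) < sum (level ∘ σ)
      smaller₂ = sum-mono-< (λ v → level₂ (part v) (σ v) (col₁ v)) l
        (level-left (part l) (σ l) (col₁ l) l-left (presentSet∋ σ l l∈S))

      -- The second colouring is used on the right and the first elsewhere. They agree on the
      -- present middle vertices, whose colours were fixed, and no present edge joins left to right.
      glue : Solution σ₂ → Solution σ
      glue (col₂ , allows₂ , proper₂) = (λ v → col (part v) v) , (λ v → allows (part v) (σ v) (allows₁ v) (allows₂ v)) , glued
        where
        col : Part → V → Fin N
        col right v = col₂ v
        col _     v = col₁ v
        allows : ∀ p t {v} → Allows (dropRight p t) (col₁ v) → Allows (fixMid p (col₁ v) t) (col₂ v) → Allows t (col p v)
        allows left  t a₁ a₂ = a₁
        allows mid   t a₁ a₂ = a₁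
        allows right t a₁ a₂ = a₂
        agree : ∀ v t → isPresent t ≡ true → Allows (fixMid mid (col₁ v) t) (col₂ v) → col₁ v ≡ col₂ v
        agree v (fixed _) _ a = a
        agree v (free _)  _ a = a
        present-mid : ∀ {c} t → isPresent t ≡ true → isPresent (fixMid mid c t) ≡ true
        present-mid (fixed _) _ = refl
        present-mid (free _)  _ = refl
        glued : ∀ u v → isPresent (σ u) ≡ true → isPresent (σ v) ≡ true → Edge G u v → col (part u) u ≢ col (part v) v
        glued u v pu pv e with part u in pu-eq | part v in pv-eq | proper₁ u v | proper₂ u v | allows₂ u | allows₂ v
        ... | left  | left  | p₁ | _  | _  | _  = p₁ pu pv e
        ... | left  | mid   | p₁ | _  | _  | _  = p₁ pu pv e
        ... | mid   | left  | p₁ | _  | _  | _  = p₁ pu pv e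
        ... | mid   | mid   | p₁ | _  | _  | _  = p₁ pu pv e
        ... | right | right | _  | p₂ | _  | _  = p₂ pu pv e
        ... | right | mid   | _  | p₂ | _  | av = λ eq → p₂ pu (present-mid (σ v) pv) e (trans eq (agree v (σ v) pv av))
        ... | mid   | right | _  | p₂ | au | _  = λ eq → p₂ (present-mid (σ u) pu) pv e (trans (sym (agree u (σ u) pu au)) eq)
        ... | left  | right | _  | _  | _  | _  = contradiction e
          (no-edge u v (∈presentSet σ u pu) (∈presentSet σ v pv) pu-eq pv-eq)
        ... | right | left  | _  | _  | _  | _  = contradiction (edge-sym e)
          (no-edge v u (∈presentSet σ v pv) (∈presentSet σ u pu) pv-eq pu-eq)

    solution : (∀ τ → Invariant τ → sum (level ∘ τ) < sum (level ∘ σ) → Solution τ) → Solution σ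
    solution rec =
      let col₁ , allows₁ , proper₁ = rec σ₁ invariant₁ smaller₁
      in glue col₁ allows₁ proper₁
           (rec (σ₂ col₁ allows₁ proper₁) (invariant₂ col₁ allows₁ proper₁) (smaller₂ col₁ allows₁ proper₁))

  -- The two sides are disjoint and together weigh at most 2k², so they cannot both exceed k².
  lighter-side : ∀ {σ} → Invariant σ → (part : V → Part) →
    sum (λ v → onRight (part v) (weight (σ v))) ≤ k * k ⊎
    sum (λ v → onRight (flip (part v)) (weight (σ v))) ≤ k * k
  lighter-side {σ} inv part with sum (λ v → onRight (part v) (weight (σ v))) ≤? k * k
  ... | yes R≤k² = inj₁ R≤k²
  ... | no  R≰k² = inj₂ (+-cancelʳ-≤ (k * k) _ _ (begin
    L + k * k                    ≤⟨ +-monoʳ-≤ L (<⇒≤ (≰⇒> R≰k²)) ⟩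
    L + R                        ≡⟨ ∑-distrib-+ (λ v → onRight (flip (part v)) (weight (σ v))) (λ v → onRight (part v) (weight (σ v))) ⟨
    sum (λ v → onRight (flip (part v)) (weight (σ v)) + onRight (part v) (weight (σ v)))
                                 ≤⟨ sum-mono-≤ (λ v → both (part v) (weight (σ v))) ⟩
    sum (weight ∘ σ)             ≤⟨ Invariant.light inv ⟩
    2 * (k * k)                  ≡⟨ cong (k * k +_) (+-identityʳ (k * k)) ⟩
    k * k + k * k                ∎))
    where
    open ≤-Reasoning
    L R : ℕ
    L = sum (λ v → onRight (flip (part v)) (weight (σ v)))
    R = sum (λ v → onRight (part v) (weight (σ v)))
    both : ∀ p w → onRight (flip p) w + onRight p w ≤ w
    both left  w = ≤-reflexive (+-identityʳ w)
    both mid   w = z≤n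
    both right w = ≤-refl

  -- Case distinction and recursion

  short⊎full : ∀ (σ : State) → (∀ v → sum (forb (σ v)) < k) ⊎ ∃ λ v → k ≤ sum (forb (σ v))
  short⊎full σ = Fin-searchable (λ v → <-≤-connex (sum (forb (σ v))) k)

  rich⊎sparse : ∀ (σ : State) → (∀ x c → FixedTo (σ x) c → k < degree σ x) ⊎
    ∃ λ x → ∃ λ c → FixedTo (σ x) c × degree σ x ≤ k
  rich⊎sparse σ = Fin-searchable (λ x → test x (σ x) (≤-<-connex (degree σ x) k))
    where
    test : ∀ x t → degree σ x ≤ k ⊎ k < degree σ x →
      (∀ c → FixedTo t c → k < degree σ x) ⊎ ∃ λ c → FixedTo t c × degree σ x ≤ k
    test x t         (inj₂ gt) = inj₁ λ _ _ → gt
    test x out       (inj₁ le) = inj₁ λ _ ()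
    test x (free _)  (inj₁ le) = inj₁ λ _ ()
    test x (fixed c) (inj₁ le) = inj₂ (c , refl , le)

  -- The order of the cases matters: deletion relies on all lists being short, and a separation is
  -- split only once every precoloured vertex has more than k free neighbours.
  solve : ∀ σ → Invariant σ → Acc _<_ (sum (level ∘ σ)) → Solution σ
  solve σ inv (acc rec) with short⊎full σ
  ... | inj₂ (v , full) =
    let c , available = some-colour {σ} inv v
        open FixStep {σ} inv v full c available
    in solution (solve σ′ invariant (rec smaller))
  ... | inj₁ short with rich⊎sparse σ
  ...   | inj₂ (x , c , x-fixed , sparse) =
    let open DeleteStep {σ} inv short x c x-fixed sparse
    in solution (solve σ′ invariant (rec smaller))
  ...   | inj₁ rich with split (presentSet σ)
  ...     | inj₂ (κ , κ-proper) =
    ColourStep.solution {σ} inv κ (λ u v pu pv → κ-proper u v (∈presentSet σ u pu) (∈presentSet σ v pv))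
  ...     | inj₁ sep with lighter-side {σ} inv (Separation.part sep)
  ...       | inj₁ le =
    let x , x-free , x-right = free-on-right {σ} rich sep
    in SeparateStep.solution {σ} inv sep le x x-free x-right (λ τ inv′ lt → solve τ inv′ (rec lt))
  ...       | inj₂ le =
    let x , x-free , x-right = free-on-right {σ} rich (flipSeparation sep)
    in SeparateStep.solution {σ} inv (flipSeparation sep) le x x-free x-right (λ τ inv′ lt → solve τ inv′ (rec lt))

  colouring : Colouring G N
  colouring = let col , _ , proper = solve (λ _ → start) start-invariant (<-wellFounded _)
              in col , λ u v → proper u v refl refl
    where
    start : Status
    -- Initially every vertex is uncoloured with an empty list, so the total weight is 0.
    start = free λ _ → false
    start-invariant : Invariant (λ _ → start)
    start-invariant = record
      { proper = λ _ _ ()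
      ; light  = ≤-trans (≤-reflexive (trans (sum-cong-≗ {size G} (λ _ → sum-zero N)) (sum-zero (size G)))) z≤n
      ; lists  = λ _ → ≤-trans (≤-reflexive (sum-zero N)) z≤n
      }

-- Deduction of the theorem from the colouring procedure

theorem1p1 : ∀ (k : ℕ) (G : Graph) → ChromaticAtLeast G (7 * k + 1) →
    Σ Graph λ H → Subgraph H G × ConnectivityAtLeast H k × ChromaticAtLeast H k
-- For k = 0 both bounds are trivial and `G` itself serves as the subgraph.
theorem1p1 zero G χ≥ = G , record { emb = λ v → v ; emb-inj = λ eq → eq ; emb-adj = λ _ _ e → e } , inj₁ refl , λ _ _ → z≤n
theorem1p1 (suc k) G χ≥ with good⊎all-split k G
... | inj₂ good  = good
... | inj₁ split = contradiction (χ≥ (7 * suc k) (Colour.colouring G (suc k) (7 * suc k) z<s refl split)) (m+1+n≰m (7 * suc k))
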